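{- Let $k\ge 2$ and $r$ be integers with $1\le r\le k$, and suppose that $k=nd$ and $r=md$ for some positive integers $n$, $m$ and $d$. Then $$|\mathcal{P}_n(r,k)|=\frac{|\mathcal{A}_n(r,k)|}{n}=\frac{1}{n}\sum_{s\mid (n,m)}\binom{n/s}{m/s}\mu(s),$$ where the sum is taken over all positive divisors $s$ of the greatest common divisor $(n,m)$. In particular, $$|\mathcal{P}_k(r,k)|=\frac{|\mathcal{A}_k(r,k)|}{k}=\frac{1}{k}\sum_{s\mid (k,r)}\binom{k/s}{r/s}\mu(s).$$
   Context: For a finite set $A$ of nonnegative integers and a positive integer $i$, let $\overline{A}(i)\subseteq\{0,1,\ldots,i-1\}$ be the set of residues modulo $i$ of the elements of $A$; two finite sets $A,B$ are called equal modulo $i$ if $\overline{A}(i)=\overline{B}(i)$. Write $A+t=\{a+t: a\in A\}$. For integers $1\le j\le i$, $\mathcal{A}(j,i)$ denotes the collection of all subsets of $\{0,1,\ldots,i-1\}$ with exactly $j$ elements. For $A\in\mathcal{A}(j,i)$, $f_i(A)$ denotes the smallest positive integer $l$ such that $A$ equals $A+l$ modulo $i$ (it exists and is at most $i$). For $1\le s\le i$, $\mathcal{A}_s(j,i)=\{A\in\mathcal{A}(j,i): f_i(A)=s\}$. Two sets $A,A'\in\mathcal{A}_n(r,k)$ are called $k$-equivalent if there exists $j\in\{0,1,\ldots,k-1\}$ such that $A+j$ equals $A'$ modulo $k$; this is an equivalence relation, and $\mathcal{P}_n(r,k)$ denotes the set of its equivalence classes in $\mathcal{A}_n(r,k)$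 (called $(r,k)$-periods with length $n$). $(x,y)$ denotes the greatest common divisor, $|\cdot|$ cardinality, and $\mu$ the Möbius function. -}

module Defs where

open import Data.Bool.Base using (if_then_else_)
open import Data.Fin.Base using (Fin; toℕ)
open import Data.Fin.Subset using (Subset; ∣_∣)
open import Data.Fin.Subset.Properties using (_∈?_)
open import Data.Integer.Base as ℤ using (ℤ; 0ℤ; -1ℤ)
open import Data.List.Base using (List; map; filter; foldr; length; allFin; upTo)
open import Data.List.Properties using (map-∘; map-cong; map-id)
open import Data.List.Relation.Binary.BagAndSetEquality as BagSet using (_∼[_]_; set; [_]-Equality)
open import Data.List.Relation.Unary.Unique.DecPropositional using (unique?)
open import Data.Nat.Base
open import Data.Nat.Divisibility using (_∣?_)
open import Data.Nat.DivMod
open import Data.Nat.Primality.Factorisation using (factorise; factors)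
open import Data.Nat.Properties
open import Data.Product.Base using (∃-syntax; _×_; _,_; proj₁; proj₂)
open import Function.Base using (_∘_)
open import Function.Bundles using (Bijection)
open import Level using (0ℓ)
open import Relation.Binary.Bundles using (Setoid)
import Relation.Binary.Construct.On as On
open import Relation.Binary.PropositionalEquality
  using (_≡_; refl; sym; trans; cong; setoid; module ≡-Reasoning)
import Relation.Binary.Reasoning.Setoid as ≈-Reasoning
open import Relation.Nullary.Decidable.Core using (does)

------------------------------------------------------------------------
-- S has exactly n elements, counted up to the equality of S.

HasCardinality : Setoid 0ℓ 0ℓ → ℕ → Set
HasCardinality S n = Bijection (setoid (Fin n)) S

------------------------------------------------------------------------
-- A finite set of nonnegative integers is a list, considered up to
-- set equality _∼[ set ]_.

infixl 6 _+ₛ_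

_+ₛ_ : List ℕ → ℕ → List ℕ
A +ₛ t = map (_+ t) A

residues : (i : ℕ) .{{_ : NonZero i}} → List ℕ → List ℕ
residues i = map (_% i)

EqualModulo : (i : ℕ) .{{_ : NonZero i}} → List ℕ → List ℕ → Set
EqualModulo i A B = residues i A ∼[ set ] residues i B

elements : ∀ {i} → Subset i → List ℕ
elements A = map toℕ (filter (_∈? A) (allFin _))

------------------------------------------------------------------------
-- IsPeriodLength i A l says that f_i(A) = l: l is the smallest positive
-- integer such that A equals A + l modulo i.

IsPeriodLength : (i : ℕ) .{{_ : NonZero i}} → Subset i → ℕ → Set
IsPeriodLength i A l =
    (0 < l × EqualModulo i (elements A) (elements A +ₛ l))
  × (∀ l′ → 0 < l′ → EqualModulo i (elements A) (elements A +ₛ l′) → l ≤ l′)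

Member : (s j i : ℕ) .{{_ : NonZero i}} → Set
Member s j i = ∃[ A ] (∣ A ∣ ≡ j × IsPeriodLength i A s)

-- 𝒜 s j i is 𝒜ₛ(j,i); two elements are equal when the underlying
-- subsets are, whatever the accompanying proofs.

𝒜 : (s j i : ℕ) .{{_ : NonZero i}} → Setoid 0ℓ 0ℓ
𝒜 s j i = On.setoid {B = Member s j i} (setoid (Subset i)) proj₁

------------------------------------------------------------------------

Equivalent : (k : ℕ) .{{_ : NonZero k}} → List ℕ → List ℕ → Set
Equivalent k A A′ = ∃[ j ] (j < k × EqualModulo k (A +ₛ j) A′)

module _ (k : ℕ) .{{_ : NonZero k}} where

  private
    open module ∼ = Setoid ([ set ]-Equality ℕ) using (_≈_)

    residues-+ₛ : ∀ A t → residues k (A +ₛ t) ≡ residues k (residues k A +ₛ t)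
    residues-+ₛ A t = begin
      map (_% k) (map (_+ t) A)                      ≡⟨ map-∘ A ⟨
      map (λ a → (a + t) % k) A                      ≡⟨ map-cong lemma A ⟩
      map (λ a → (a % k + t) % k) A                  ≡⟨ map-∘ A ⟩
      map (λ r → (r + t) % k) (map (_% k) A)         ≡⟨ map-∘ (map (_% k) A) ⟩
      map (_% k) (map (_+ t) (map (_% k) A))         ∎
      where
      open ≡-Reasoning
      lemma : ∀ a → (a + t) % k ≡ (a % k + t) % k
      lemma a = begin
        (a + t) % k                ≡⟨ %-distribˡ-+ a t k ⟩
        (a % k + t % k) % k        ≡⟨ cong (λ x → (x + t % k) % k) (m%n%n≡m%n a k) ⟨
        (a % k % k + t % k) % k    ≡⟨ %-distribˡ-+ (a % k) t k ⟨
        (a % k + t) % k            ∎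

    +ₛ-congˡ : ∀ {A B} t → EqualModulo k A B → EqualModulo k (A +ₛ t) (B +ₛ t)
    +ₛ-congˡ {A} {B} t A∼B = begin
      residues k (A +ₛ t)              ≡⟨ residues-+ₛ A t ⟩
      residues k (residues k A +ₛ t)   ≈⟨ BagSet.map-cong (λ _ → refl)
                                            (BagSet.map-cong (λ _ → refl) A∼B) ⟩
      residues k (residues k B +ₛ t)   ≡⟨ residues-+ₛ B t ⟨
      residues k (B +ₛ t)              ∎
      where open ≈-Reasoning ([ set ]-Equality ℕ)

    +ₛ-congʳ : ∀ A {t u} → t % k ≡ u % k → residues k (A +ₛ t) ≡ residues k (A +ₛ u)
    +ₛ-congʳ A {t} {u} t≡u = begin
      map (_% k) (map (_+ t) A)    ≡⟨ map-∘ A ⟨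
      map (λ a → (a + t) % k) A    ≡⟨ map-cong lemma A ⟩
      map (λ a → (a + u) % k) A    ≡⟨ map-∘ A ⟩
      map (_% k) (map (_+ u) A)    ∎
      where
      open ≡-Reasoning
      lemma : ∀ a → (a + t) % k ≡ (a + u) % k
      lemma a = begin
        (a + t) % k            ≡⟨ %-distribˡ-+ a t k ⟩
        (a % k + t % k) % k    ≡⟨ cong (λ x → (a % k + x) % k) t≡u ⟩
        (a % k + u % k) % k    ≡⟨ %-distribˡ-+ a u k ⟨
        (a + u) % k            ∎

    +ₛ-assoc : ∀ A t u → A +ₛ t +ₛ u ≡ A +ₛ (t + u)
    +ₛ-assoc A t u = trans (sym (map-∘ A)) (map-cong (λ a → +-assoc a t u) A)

    +ₛ-identityʳ : ∀ A → A +ₛ 0 ≡ A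
    +ₛ-identityʳ A = trans (map-cong +-identityʳ A) (map-id A)

    reduce : ∀ {A B} t → EqualModulo k (A +ₛ t) B → Equivalent k A B
    reduce {A} {B} t A+t∼B = t % k , m%n<n t k , (begin
      residues k (A +ₛ (t % k))   ≡⟨ +ₛ-congʳ A (m%n%n≡m%n t k) ⟩
      residues k (A +ₛ t)         ≈⟨ A+t∼B ⟩
      residues k B                ∎)
      where open ≈-Reasoning ([ set ]-Equality ℕ)

  equivalent-refl : ∀ {A} → Equivalent k A A
  equivalent-refl {A} = reduce 0 (∼.reflexive (cong (residues k) (+ₛ-identityʳ A)))

  equivalent-sym : ∀ {A B} → Equivalent k A B → Equivalent k B A
  equivalent-sym {A} {B} (j , j<k , A+j∼B) = reduce (k ∸ j) (begin
    residues k (B +ₛ (k ∸ j))           ≈⟨ +ₛ-congˡ {A +ₛ j} {B} (k ∸ j) A+j∼B ⟨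
    residues k (A +ₛ j +ₛ (k ∸ j))      ≡⟨ cong (residues k) (+ₛ-assoc A j (k ∸ j)) ⟩
    residues k (A +ₛ (j + (k ∸ j)))     ≡⟨ cong (λ t → residues k (A +ₛ t)) (m+[n∸m]≡n (<⇒≤ j<k)) ⟩
    residues k (A +ₛ k)                 ≡⟨ +ₛ-congʳ A ([m+n]%n≡m%n 0 k) ⟩
    residues k (A +ₛ 0)                 ≡⟨ cong (residues k) (+ₛ-identityʳ A) ⟩
    residues k A                        ∎)
    where open ≈-Reasoning ([ set ]-Equality ℕ)

  equivalent-trans : ∀ {A B C} → Equivalent k A B → Equivalent k B C → Equivalent k A C
  equivalent-trans {A} {B} {C} (j , _ , A+j∼B) (j′ , _ , B+j′∼C) = reduce (j + j′) (begin
    residues k (A +ₛ (j + j′))    ≡⟨ cong (residues k) (+ₛ-assoc A j j′) ⟨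
    residues k (A +ₛ j +ₛ j′)     ≈⟨ +ₛ-congˡ {A +ₛ j} {B} j′ A+j∼B ⟩
    residues k (B +ₛ j′)          ≈⟨ B+j′∼C ⟩
    residues k C                  ∎)
    where open ≈-Reasoning ([ set ]-Equality ℕ)

  equivalenceSetoid : Setoid 0ℓ 0ℓ
  equivalenceSetoid = record
    { Carrier       = List ℕ
    ; _≈_           = Equivalent k
    ; isEquivalence = record
      { refl  = equivalent-refl
      ; sym   = equivalent-sym
      ; trans = equivalent-trans
      }
    }

-- 𝒫 n r k is 𝒫ₙ(r,k): the elements of 𝒜ₙ(r,k) up to k-equivalence, so
-- that its cardinality counts equivalence classes.

𝒫 : (n r k : ℕ) .{{_ : NonZero k}} → Setoid 0ℓ 0ℓ
𝒫 n r k = On.setoid {B = Member n r k} (equivalenceSetoid k) (elements ∘ proj₁)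

------------------------------------------------------------------------
-- factors lists the prime factors with multiplicity, so unique? tests
-- squarefreeness.

μ : (n : ℕ) .{{_ : NonZero n}} → ℤ
μ n = if does (unique? _≟_ ps) then -1ℤ ℤ.^ length ps else 0ℤ
  where ps = factors (factorise n)

-- The sum of f over the positive divisors of n, for n positive; each
-- divisor is written suc i to make it visibly nonzero.

divisorSum : (n : ℕ) → ((s : ℕ) .{{_ : NonZero s}} → ℤ) → ℤ
divisorSum n f = foldr ℤ._+_ 0ℤ (map (λ i → f (suc i)) (filter (λ i → suc i ∣? n) (upTo n)))

{-# OPTIONS --safe #-}
-- Identify a subset of {0,…,k−1} with its k-periodic characteristic sequence χ.
-- Its periods are then the multiples of a least one, and f_k(A) = n says that this
-- least period is n.  The classes of k-equivalence in 𝒜ₙ(r,k) are the orbits under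
-- rotation, and each has exactly n elements, which gives |𝒜ₙ| = n |𝒫ₙ|.
--
-- For s ∣ (n,m) the sets of size r with period n/s number C(n/s, m/s), being the
-- repetitions of the m/s-element subsets of ℤ/(n/s).  So the right-hand side is
-- Σ_A Σ_s μ(s), over the sets A of size r and those s ∣ (n,m) for which n/s is a
-- period of A.  If A has least period n/t, these s are the divisors of t, and the
-- inner sum is [t = 1].
module Submission where

open import Defs
open import Data.Bool.Base using (Bool; true; false; if_then_else_)
import Data.Bool.Properties as Bool
open import Data.Fin.Base using (toℕ; zero; suc)
import Data.Fin.Properties as Fin
open import Data.Fin.Subset using (Subset; ∣_∣)
open import Data.Fin.Subset.Properties using (_∈?_)
open import Data.Integer.Base as ℤ using (ℤ; +_; 0ℤ; 1ℤ; -1ℤ)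
import Data.Integer.Properties as ℤ
open import Data.List.Base
  using (List; []; _∷_; map; filter; foldr; length; upTo; allFin; _++_; lookup; concat; applyUpTo)
import Data.List.Properties as List
open import Data.List.Membership.Propositional using (_∈_; find)
open import Data.List.Membership.Propositional.Properties
open import Data.List.Membership.Propositional.Properties.WithK using (unique∧set⇒bag)
open import Data.List.Relation.Binary.BagAndSetEquality using (∼bag⇒↭)
open import Data.List.Relation.Binary.Disjoint.Propositional using (Disjoint)
open import Data.List.Relation.Binary.Permutation.Propositional as ↭ using (_↭_; ↭⇒↭ₛ)
open import Data.List.Relation.Binary.Permutation.Propositional.Properties using (↭-length)
import Data.List.Relation.Binary.Permutation.Setoid.Properties as ↭ₛ
open import Data.List.Relation.Unary.All as All using (All; []; _∷_)
import Data.List.Relation.Unary.All.Properties as All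
open import Data.List.Relation.Unary.AllPairs as AllPairs using (AllPairs; []; _∷_)
import Data.List.Relation.Unary.AllPairs.Properties as AllPairs
open import Data.List.Relation.Unary.Any as Any using (Any; here; there)
import Data.List.Relation.Unary.Any.Properties as Any
open import Data.List.Relation.Unary.Unique.DecPropositional using (unique?)
open import Data.List.Relation.Unary.Unique.Propositional using (Unique)
import Data.List.Relation.Unary.Unique.Propositional.Properties as Unique
open import Data.Nat.Base
open import Data.Nat.Combinatorics using (_C_; nCk+nC[k+1]≡[n+1]C[k+1])
open import Data.Nat.DivMod
open import Data.Nat.Divisibility
open import Data.Nat.GCD using (gcd; gcd[m,n]≢0; gcd[m,n]∣m; gcd[m,n]∣n; gcd-greatest)
open import Data.Nat.Induction using (<-rec)
open import Data.Nat.ListAction using (product)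
open import Data.Nat.ListAction.Properties using (∈⇒∣product)
open import Data.Nat.Primality using (Prime; euclidsLemma; prime⇒nonZero)
open import Data.Nat.Primality.Factorisation
open import Data.Nat.Properties
open import Data.Product.Base using (∃; ∃₂; _×_; _,_; proj₁; proj₂)
open import Data.Rational.Base as ℚ using ()
open import Data.Rational.Properties using (fromℚᵘ-cong)
open import Data.Rational.Unnormalised.Base using (mkℚᵘ; *≡*)
open import Data.Sum.Base using (inj₁; inj₂)
open import Data.Vec.Base as Vec using ([]; _∷_; tabulate)
import Data.Vec.Properties as Vec
open import Function.Base using (_∘_; id; _on_)
open import Function.Bundles using (_⇔_; mk⇔; Equivalence)
open import Level using (0ℓ)
open import Relation.Binary.Bundles using (Setoid)
open import Relation.Binary.Core using (Rel)
open import Relation.Binary.Definitions using (Reflexive; Symmetric; Transitive)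
open import Relation.Binary.PropositionalEquality
  using (_≡_; _≢_; refl; sym; trans; cong; cong₂; subst; setoid; module ≡-Reasoning)
open import Relation.Binary.Structures using (IsEquivalence)
open import Relation.Nullary using (¬_; Dec; does; yes; no)
open import Relation.Nullary.Decidable using (¬?; dec-true; dec-false; decidable-stable; map′; _×-dec_)
open import Relation.Nullary.Negation using (contradiction)
open import Relation.Unary using (Decidable)

open import Algebra.Properties.CommutativeSemigroup ℤ.+-commutativeSemigroup
  using (interchange; x∙yz≈y∙xz)
open import Algebra.Properties.CommutativeSemigroup +-commutativeSemigroup
  using () renaming (xy∙z≈xz∙y to [m+n]+o≡[m+o]+n)
open import Algebra.Properties.CommutativeSemigroup *-commutativeSemigroup
  using () renaming (xy∙z≈xz∙y to [m*n]*o≡[m*o]*n)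

open Equivalence using (to; from)

private variable
  A B : Set
  P : A → Set

-- Lists and sums over them

-- Every bijective count below runs through this: two repetition-free lists with the same members
-- have equal lengths and equal sums.
unique-↭ : {xs ys : List A} → Unique xs → Unique ys →
           (∀ {x} → x ∈ xs → x ∈ ys) → (∀ {x} → x ∈ ys → x ∈ xs) → xs ↭ ys
unique-↭ xs! ys! xs⊆ys ys⊆xs = ∼bag⇒↭ (unique∧set⇒bag xs! ys! (mk⇔ xs⊆ys ys⊆xs))

sumOver : (A → ℤ) → List A → ℤ
sumOver f xs = foldr ℤ._+_ 0ℤ (map f xs)

sumOver-↭ : ∀ (f : A → ℤ) {xs ys} → xs ↭ ys → sumOver f xs ≡ sumOver f ys
sumOver-↭ f ↭.refl = refl
sumOver-↭ f (↭.prep x p) = cong (ℤ._+_ (f x)) (sumOver-↭ f p)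
sumOver-↭ f (↭.swap {xs} {ys} x y p) = begin
  f x ℤ.+ (f y ℤ.+ sumOver f xs)  ≡⟨ ℤ.+-assoc (f x) _ _ ⟨
  f x ℤ.+ f y ℤ.+ sumOver f xs    ≡⟨ cong₂ ℤ._+_ (ℤ.+-comm (f x) _) (sumOver-↭ f p) ⟩
  f y ℤ.+ f x ℤ.+ sumOver f ys    ≡⟨ ℤ.+-assoc (f y) _ _ ⟩
  f y ℤ.+ (f x ℤ.+ sumOver f ys)  ∎
  where open ≡-Reasoning
sumOver-↭ f (↭.trans p q) = trans (sumOver-↭ f p) (sumOver-↭ f q)

sumOver-cong : ∀ {f g : A → ℤ} xs → (∀ {x} → x ∈ xs → f x ≡ g x) → sumOver f xs ≡ sumOver g xs
sumOver-cong []       f≗g = refl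
sumOver-cong (x ∷ xs) f≗g = cong₂ ℤ._+_ (f≗g (here refl)) (sumOver-cong xs (f≗g ∘ there))

sumOver-map : ∀ (f : B → ℤ) (g : A → B) xs → sumOver f (map g xs) ≡ sumOver (f ∘ g) xs
sumOver-map f g xs = cong (foldr ℤ._+_ 0ℤ) (sym (List.map-∘ xs))

sumOver-neg : ∀ (f : A → ℤ) xs → sumOver (λ x → ℤ.- f x) xs ≡ ℤ.- sumOver f xs
sumOver-neg f []       = refl
sumOver-neg f (x ∷ xs) =
  trans (cong (ℤ._+_ (ℤ.- f x)) (sumOver-neg f xs)) (sym (ℤ.neg-distrib-+ (f x) _))

sumOver-filter : ∀ (P? : Decidable P) (f : A → ℤ) xs →
                 (∀ {x} → x ∈ xs → ¬ P x → f x ≡ 0ℤ) → sumOver f (filter P? xs) ≡ sumOver f xs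
sumOver-filter P? f []       f≗0 = refl
sumOver-filter P? f (x ∷ xs) f≗0 with P? x
... | yes _ = cong (ℤ._+_ (f x)) (sumOver-filter P? f xs (f≗0 ∘ there))
... | no ¬p = begin
  sumOver f (filter P? xs)  ≡⟨ sumOver-filter P? f xs (f≗0 ∘ there) ⟩
  sumOver f xs              ≡⟨ ℤ.+-identityˡ _ ⟨
  0ℤ ℤ.+ sumOver f xs       ≡⟨ cong (ℤ._+ sumOver f xs) (f≗0 (here refl) ¬p) ⟨
  f x ℤ.+ sumOver f xs      ∎
  where open ≡-Reasoning

sumOver-split : ∀ (P? : Decidable P) (f : A → ℤ) xs →
                sumOver f xs ≡ sumOver f (filter P? xs) ℤ.+ sumOver f (filter (¬? ∘ P?) xs)
sumOver-split P? f []       = refl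
sumOver-split P? f (x ∷ xs) with P? x
... | yes _ = trans (cong (ℤ._+_ (f x)) (sumOver-split P? f xs)) (sym (ℤ.+-assoc (f x) _ _))
... | no _  = begin
  f x ℤ.+ sumOver f xs   ≡⟨ cong (ℤ._+_ (f x)) (sumOver-split P? f xs) ⟩
  f x ℤ.+ (s ℤ.+ t)      ≡⟨ ℤ.+-assoc (f x) s t ⟨
  f x ℤ.+ s ℤ.+ t        ≡⟨ cong (ℤ._+ t) (ℤ.+-comm (f x) s) ⟩
  s ℤ.+ f x ℤ.+ t        ≡⟨ ℤ.+-assoc s (f x) t ⟩
  s ℤ.+ (f x ℤ.+ t)      ∎
  where
  open ≡-Reasoning
  s = sumOver f (filter P? xs)
  t = sumOver f (filter (¬? ∘ P?) xs)

sumOver-indicator : ∀ (P? : Decidable P) (f : A → ℤ) xs →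
                    (∀ {x} → x ∈ xs → P x → f x ≡ 1ℤ) →
                    (∀ {x} → x ∈ xs → ¬ P x → f x ≡ 0ℤ) →
                    sumOver f xs ≡ + length (filter P? xs)
sumOver-indicator P? f []       f≗1 f≗0 = refl
sumOver-indicator P? f (x ∷ xs) f≗1 f≗0 with P? x
... | yes p = cong₂ ℤ._+_ (f≗1 (here refl) p) (sumOver-indicator P? f xs (f≗1 ∘ there) (f≗0 ∘ there))
... | no ¬p = trans (cong₂ ℤ._+_ (f≗0 (here refl) ¬p) (sumOver-indicator P? f xs (f≗1 ∘ there) (f≗0 ∘ there)))
                    (ℤ.+-identityˡ _)

-- Both sides add up `f x` over the pairs with `R x y`, grouped by `x` on the left and by `y` on the
-- right.
sumOver-double-count : ∀ {R : A → B → Set} (R? : ∀ x y → Dec (R x y)) (f : A → ℤ) xs ys →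
  sumOver (λ x → + length (filter (R? x) ys) ℤ.* f x) xs ≡
  sumOver (λ y → sumOver f (filter (λ x → R? x y) xs)) ys
sumOver-double-count R? f []       ys = sym (zeros ys)
  where
  zeros : ∀ ys → sumOver (λ _ → 0ℤ) ys ≡ 0ℤ
  zeros []       = refl
  zeros (_ ∷ ys) = trans (ℤ.+-identityˡ _) (zeros ys)
sumOver-double-count R? f (x ∷ xs) ys =
  trans (cong (ℤ._+_ (+ length (filter (R? x) ys) ℤ.* f x)) (sumOver-double-count R? f xs ys)) (step ys)
  where
  open ≡-Reasoning
  T = λ y → sumOver f (filter (λ x → R? x y) xs)
  -- The new entry `x` adds `f x` to the inner sum of every `y` it is related to; induction on `ys`
  -- collects these summands into one multiple of `f x`.
  step : ∀ ys → + length (filter (R? x) ys) ℤ.* f x ℤ.+ sumOver T ys ≡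
                sumOver (λ y → sumOver f (filter (λ x → R? x y) (x ∷ xs))) ys
  step []       = refl
  step (y ∷ ys) with R? x y
  ... | yes _ = begin
    (1ℤ ℤ.+ l) ℤ.* f x ℤ.+ (T y ℤ.+ S)           ≡⟨ cong (ℤ._+ (T y ℤ.+ S)) (ℤ.*-distribʳ-+ (f x) 1ℤ l) ⟩
    (1ℤ ℤ.* f x ℤ.+ l ℤ.* f x) ℤ.+ (T y ℤ.+ S)   ≡⟨ cong (λ z → (z ℤ.+ l ℤ.* f x) ℤ.+ (T y ℤ.+ S)) (ℤ.*-identityˡ (f x)) ⟩
    (f x ℤ.+ l ℤ.* f x) ℤ.+ (T y ℤ.+ S)          ≡⟨ interchange (f x) (l ℤ.* f x) (T y) S ⟩
    (f x ℤ.+ T y) ℤ.+ (l ℤ.* f x ℤ.+ S)          ≡⟨ cong (ℤ._+_ (f x ℤ.+ T y)) (step ys) ⟩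
    (f x ℤ.+ T y) ℤ.+ _                          ∎
    where
    l = + length (filter (R? x) ys)
    S = sumOver T ys
  ... | no _ = begin
    l ℤ.* f x ℤ.+ (T y ℤ.+ S)   ≡⟨ x∙yz≈y∙xz (l ℤ.* f x) (T y) S ⟩
    T y ℤ.+ (l ℤ.* f x ℤ.+ S)   ≡⟨ cong (ℤ._+_ (T y)) (step ys) ⟩
    T y ℤ.+ _                   ∎
    where
    l = + length (filter (R? x) ys)
    S = sumOver T ys

-- Enumerating a setoid by pairwise inequivalent representatives

module _ {_~_ : Rel A 0ℓ} (~-sym : Symmetric _~_) where

  lookup-injective : ∀ {xs} → AllPairs (λ x y → ¬ x ~ y) xs →
                     ∀ i j → lookup xs i ~ lookup xs j → i ≡ j
  lookup-injective (_ ∷ _)    zero    zero    _   = refl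
  lookup-injective (x≁ ∷ _)   zero    (suc j) eq  = contradiction eq (All.lookup x≁ (∈-lookup j))
  -- `AllPairs` compares an entry only with later ones, so this order of indices has to be turned
  -- round by symmetry.
  lookup-injective (x≁ ∷ _)   (suc i) zero    eq  = contradiction (~-sym eq) (All.lookup x≁ (∈-lookup i))
  lookup-injective (_ ∷ xs≁)  (suc i) (suc j) eq  = cong suc (lookup-injective xs≁ i j eq)

-- The equivalence proof is an argument of its own, so that at a concrete setoid it is not
-- compared by unfolding.
enumeration : ∀ {P : A → Set} {_~_ : Rel A 0ℓ} (isEquivalence : IsEquivalence {A = ∃ P} (_~_ on proj₁)) →
              Symmetric _~_ → ∀ xs → All P xs → AllPairs (λ x y → ¬ x ~ y) xs →
              (∀ {y} → P y → Any (_~ y) xs) →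
              HasCardinality (record { isEquivalence = isEquivalence }) (length xs)
enumeration isEquivalence ~-sym xs Pxs xs≁ complete = record
  { to        = λ i → lookup xs i , All.lookup Pxs (∈-lookup i)
  ; cong      = λ { {i} refl → IsEquivalence.refl isEquivalence {lookup xs i , All.lookup Pxs (∈-lookup i)} }
  ; bijective = (λ {i} {j} → lookup-injective ~-sym xs≁ i j)
              , λ (y , Py) → Any.index (complete Py) , λ { refl → Any.lookup-index (complete Py) }
  }

-- Greedy choice from the right: an entry becomes a representative exactly when it is related to
-- none of those chosen from the tail.
∃-representatives : ∀ {_~_ : Rel A 0ℓ} → Reflexive _~_ → (∀ x y → Dec (x ~ y)) → ∀ xs →
  ∃ λ rs → (∀ {r} → r ∈ rs → r ∈ xs) × AllPairs (λ r s → ¬ r ~ s) rs ×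
           (∀ {x} → x ∈ xs → Any (x ~_) rs)
∃-representatives ~-refl _~?_ [] = [] , id , [] , λ ()
∃-representatives ~-refl _~?_ (x ∷ xs) with ∃-representatives ~-refl _~?_ xs
... | rs , rs⊆xs , rs≁ , cover with Any.any? (x ~?_) rs
... | yes x~ = rs , there ∘ rs⊆xs , rs≁ , λ { (here refl) → x~ ; (there y∈) → cover y∈ }
... | no ¬x~ = x ∷ rs
  , (λ { (here refl) → here refl ; (there r∈) → there (rs⊆xs r∈) })
  , All.¬Any⇒All¬ rs ¬x~ ∷ rs≁
  , λ { (here refl) → here ~-refl ; (there y∈) → there (cover y∈) }

length-concat-map : ∀ (f : A → List B) {n} → (∀ x → length (f x) ≡ n) →
                    ∀ xs → length (concat (map f xs)) ≡ length xs * n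
length-concat-map f len []       = refl
length-concat-map f len (x ∷ xs) =
  trans (List.length-++ (f x)) (cong₂ _+_ (len x) (length-concat-map f len xs))

-- The Möbius function

-- As in divisorSum, the index i stands for the divisor suc i.
divisors : ℕ → List ℕ
divisors n = filter (λ i → suc i ∣? n) (upTo n)

divisors-unique : ∀ n → Unique (divisors n)
divisors-unique n = Unique.filter⁺ (λ i → suc i ∣? n) (Unique.upTo⁺ n)

∈-divisors⁺ : ∀ {n i} .{{_ : NonZero n}} → suc i ∣ n → i ∈ divisors n
∈-divisors⁺ {n} i∣n = ∈-filter⁺ (λ i → suc i ∣? n) (∈-upTo⁺ (∣⇒≤ i∣n)) i∣n

∈-divisors⁻ : ∀ {n i} → i ∈ divisors n → suc i ∣ n
∈-divisors⁻ {n} i∈ = proj₂ (∈-filter⁻ (λ i → suc i ∣? n) {xs = upTo n} i∈)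

∣⇒NonZero : ∀ {d n} .{{_ : NonZero n}} → d ∣ n → NonZero d
∣⇒NonZero {zero}  {n} d∣n = contradiction (0∣⇒≡0 d∣n) (≢-nonZero⁻¹ n)
∣⇒NonZero {suc _} d∣n = _

-- The body of `μ` as a function of the list of prime factors, so that it can be evaluated at any
-- factorisation and not only at the one computed by `factorise`.
sign : List ℕ → ℤ
sign ps = if does (unique? _≟_ ps) then -1ℤ ℤ.^ length ps else 0ℤ

sign-unique : ∀ {ps} → Unique ps → sign ps ≡ -1ℤ ℤ.^ length ps
sign-unique {ps} ps! rewrite dec-true (unique? _≟_ ps) ps! = refl

sign-¬unique : ∀ {ps} → ¬ Unique ps → sign ps ≡ 0ℤ
sign-¬unique {ps} ¬ps! rewrite dec-false (unique? _≟_ ps) ¬ps! = refl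

-- Repetitions and length do not depend on the order, and prime factorisations are unique only up to
-- order.
sign-↭ : ∀ {ps qs} → ps ↭ qs → sign ps ≡ sign qs
sign-↭ {ps} {qs} p with unique? _≟_ ps
... | yes ps! = sym (trans (sign-unique (↭ₛ.Unique-resp-↭ (setoid ℕ) (↭⇒↭ₛ p) ps!))
                           (cong (-1ℤ ℤ.^_) (sym (↭-length p))))
... | no ¬ps! = sym (sign-¬unique (¬ps! ∘ ↭ₛ.Unique-resp-↭ (setoid ℕ) (↭⇒↭ₛ (↭.↭-sym p))))

module _ {p s t} .{{_ : NonZero s}} .{{_ : NonZero t}} (pr : Prime p) (t≡p*s : t ≡ p * s) where
  private
    open PrimeFactorisation (factorise s) using (isFactorisation; factorsPrime)
    qs = factors (factorise s)

    -- Prepending `p` to the prime factors of `s` gives a factorisation of `t`.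
    μ-sign : μ t ≡ sign (p ∷ qs)
    μ-sign = sign-↭ (factorisationUnique (factorise t) record
      { factors         = p ∷ qs
      ; isFactorisation = trans t≡p*s (cong (p *_) isFactorisation)
      ; factorsPrime    = pr ∷ factorsPrime
      })

    ∈qs⇒∣s : p ∈ qs → p ∣ s
    ∈qs⇒∣s p∈ = subst (p ∣_) (sym isFactorisation) (∈⇒∣product p∈)

  -- As `p` does not occur among the factors of `s`, prepending it creates no repetition and adds
  -- one sign; a repetition already present makes both sides zero.
  μ-prime-*-∤ : ¬ p ∣ s → μ t ≡ ℤ.- μ s
  μ-prime-*-∤ p∤s with unique? _≟_ qs
  ... | yes qs! = trans μ-sign (trans (sign-unique {p ∷ qs} (All.¬Any⇒All¬ qs (p∤s ∘ ∈qs⇒∣s) ∷ qs!))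
                    (ℤ.-1*i≡-i _))
  ... | no ¬qs! = trans μ-sign (sign-¬unique {p ∷ qs} λ { (_ ∷ qs!) → ¬qs! qs! })

  -- Here `p` is already a factor of `s`, so `p ∷ qs` contains it twice.
  μ-prime-*-∣ : p ∣ s → μ t ≡ 0ℤ
  μ-prime-*-∣ p∣s = trans μ-sign (sign-¬unique {p ∷ qs} λ { (p∉ ∷ _) → All.All¬⇒¬Any p∉
    (factorisationHasAllPrimeFactors pr (subst (p ∣_) isFactorisation p∣s) factorsPrime) })

∃-prime-divisor : ∀ n → 1 < n → ∃ λ p → Prime p × p ∣ n
∃-prime-divisor n@(suc _) 1<n with factorise n
... | record { factors = [] ; isFactorisation = n≡1 } = contradiction n≡1 (>⇒≢ 1<n)
... | record { factors = p ∷ ps ; isFactorisation = n≡ ; factorsPrime = pr ∷ _ } =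
  p , pr , divides (product ps) (trans n≡ (*-comm p _))

-- The squarefree divisors of n pair up as s ↔ p s for a fixed prime p dividing n.
sum-μ≡0 : ∀ n → 1 < n → sumOver (λ i → μ (suc i)) (divisors n) ≡ 0ℤ
sum-μ≡0 n@(suc _) 1<n with ∃-prime-divisor n 1<n
... | p , pr , p∣n = begin
  sumOver M (divisors n)             ≡⟨ sumOver-split P? M (divisors n) ⟩
  sumOver M F ℤ.+ sumOver M E        ≡⟨ cong (ℤ._+ sumOver M E) F≡-E ⟩
  ℤ.- sumOver M E ℤ.+ sumOver M E    ≡⟨ ℤ.+-inverseˡ (sumOver M E) ⟩
  0ℤ                                 ∎
  where
  open ≡-Reasoning
  instance
    p≢0 : NonZero p
    p≢0 = prime⇒nonZero pr
  M = λ i → μ (suc i)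
  P? = λ i → p ∣? suc i
  Q? = λ i → ¬? (p * p ∣? suc i)
  -- The divisors are split into those prime to `p` in `E` and the multiples of `p` in `F`; `G`
  -- keeps from `F` those not divisible by `p²`.
  E = filter (¬? ∘ P?) (divisors n)
  F = filter P? (divisors n)
  G = filter Q? F
  -- Multiplication of divisors by `p`, transported to the indices, where `i` stands for `suc i`.
  h = λ i → pred (p * suc i)

  suc-h : ∀ i → suc (h i) ≡ p * suc i
  suc-h i = suc-pred (p * suc i) {{m*n≢0 p (suc i)}}

  h-injective : ∀ {i j} → h i ≡ h j → i ≡ j
  h-injective {i} {j} eq = suc-injective (*-cancelˡ-≡ (suc i) (suc j) p
    (trans (sym (suc-h i)) (trans (cong suc eq) (suc-h j))))

  -- The quotient by `p` lies in `E`, for a second factor `p` would make `p²` divide.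
  G⊆hE : ∀ {i} → i ∈ G → i ∈ map h E
  G⊆hE {i} i∈G with ∈-filter⁻ Q? {xs = F} i∈G
  ... | i∈F , pp∤ with ∈-filter⁻ P? {xs = divisors n} i∈F
  ... | i∈D , divides zero ()
  ... | i∈D , divides (suc q) eq = subst (_∈ map h E) (suc-injective (trans (suc-h q) (sym eq′)))
    (∈-map⁺ h (∈-filter⁺ (¬? ∘ P?)
      (∈-divisors⁺ (∣-trans (divides p eq′) (∈-divisors⁻ {n} i∈D)))
      (λ p∣q → pp∤ (subst (p * p ∣_) (sym eq′) (*-monoʳ-∣ p p∣q)))))
    where eq′ = trans eq (*-comm (suc q) p)

  -- Euclid's lemma puts the prime `p` into the cofactor of `suc i` in `n`.
  p*∣n : ∀ {i} → suc i ∣ n → ¬ p ∣ suc i → p * suc i ∣ n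
  p*∣n {i} (divides c eq) p∤i with euclidsLemma c (suc i) pr (subst (p ∣_) eq p∣n)
  ... | inj₁ p∣c = subst (p * suc i ∣_) (sym eq) (*-monoˡ-∣ (suc i) p∣c)
  ... | inj₂ p∣i = contradiction p∣i p∤i

  hE⊆G : ∀ {i} → i ∈ map h E → i ∈ G
  hE⊆G i∈ with ∈-map⁻ h i∈
  ... | j , j∈E , refl with ∈-filter⁻ (¬? ∘ P?) {xs = divisors n} j∈E
  ... | j∈D , p∤j = ∈-filter⁺ Q?
    (∈-filter⁺ P? (∈-divisors⁺ (subst (_∣ n) (sym (suc-h j)) (p*∣n (∈-divisors⁻ {n} j∈D) p∤j)))
                  (subst (p ∣_) (sym (suc-h j)) (m∣m*n (suc j))))
    (λ pp∣ → p∤j (*-cancelˡ-∣ p (subst (p * p ∣_) (suc-h j) pp∣)))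

  F≡-E : sumOver M F ≡ ℤ.- sumOver M E
  F≡-E = begin
    sumOver M F                       ≡⟨ sumOver-filter Q? M F vanish ⟨
    sumOver M G                       ≡⟨ sumOver-↭ M (unique-↭
      (Unique.filter⁺ Q? (Unique.filter⁺ P? (divisors-unique n)))
      (Unique.map⁺ h-injective (Unique.filter⁺ (¬? ∘ P?) (divisors-unique n))) G⊆hE hE⊆G) ⟩
    sumOver M (map h E)               ≡⟨ sumOver-map M h E ⟩
    sumOver (M ∘ h) E                 ≡⟨ sumOver-cong E (λ {i} i∈E →
      μ-prime-*-∤ pr (suc-h i) (proj₂ (∈-filter⁻ (¬? ∘ P?) {xs = divisors n} i∈E))) ⟩
    sumOver (λ i → ℤ.- M i) E         ≡⟨ sumOver-neg M E ⟩
    ℤ.- sumOver M E                   ∎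
    where
    -- A multiple `q p²` is `p` times `q p`, and `p` divides `q p`.
    vanish : ∀ {i} → i ∈ F → ¬ ¬ (p * p ∣ suc i) → M i ≡ 0ℤ
    vanish {i} i∈F ¬¬pp∣ with decidable-stable (p * p ∣? suc i) ¬¬pp∣
    ... | divides zero ()
    ... | divides q@(suc _) eq = μ-prime-*-∣ {{m*n≢0 q p}} pr
      (trans eq (trans (sym (*-assoc q p p)) (*-comm (q * p) p))) (n∣m*n q)

-- Periods of Boolean sequences

Period : (ℕ → Bool) → ℕ → Set
Period g l = ∀ x → g (x + l) ≡ g x

MinimalPeriod : (ℕ → Bool) → ℕ → Set
MinimalPeriod g n = (0 < n × Period g n) × (∀ l → 0 < l → Period g l → n ≤ l)

∃-least : {P : ℕ → Set} → Decidable P → ∀ n → P n → ∃ λ m → P m × (∀ j → P j → m ≤ j)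
∃-least {P} P? = <-rec _ search
  where
  search : ∀ n → (∀ {m} → m < n → P m → ∃ λ m → P m × (∀ j → P j → m ≤ j)) →
           P n → ∃ λ m → P m × (∀ j → P j → m ≤ j)
  search n rec Pn with anyUpTo? P? n
  ... | yes (m , m<n , Pm) = rec m<n Pm
  ... | no ∄ = n , Pn , λ j Pj → ≮⇒≥ λ j<n → ∄ (j , j<n , Pj)

module _ {g : ℕ → Bool} where

  period-* : ∀ {l} → Period g l → ∀ q → Period g (q * l)
  period-* per zero    x = cong g (+-identityʳ x)
  period-* {l} per (suc q) x = begin
    g (x + (l + q * l))  ≡⟨ cong g (+-assoc x l (q * l)) ⟨
    g (x + l + q * l)    ≡⟨ period-* per q (x + l) ⟩
    g (x + l)            ≡⟨ per x ⟩
    g x                  ∎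
    where open ≡-Reasoning

  period-∣ : ∀ {l m} → Period g l → l ∣ m → Period g m
  period-∣ per (divides q refl) = period-* per q

  period-%-invariant : ∀ {f} .{{_ : NonZero f}} → Period g f → ∀ x l → g (x + l % f) ≡ g (x + l)
  period-%-invariant {f} per x l = begin
    g (x + l % f)                  ≡⟨ period-* per (l / f) _ ⟨
    g (x + l % f + l / f * f)      ≡⟨ cong g (+-assoc x (l % f) _) ⟩
    g (x + (l % f + l / f * f))    ≡⟨ cong (λ z → g (x + z)) (m≡m%n+[m/n]*n l f) ⟨
    g (x + l)                      ∎
    where open ≡-Reasoning

  -- The remainder of `l` modulo `f` acts as a period too; being smaller than `f`, it must be zero.
  minimalPeriod-∣ : ∀ {f l} → MinimalPeriod g f → Period g l → f ∣ l
  minimalPeriod-∣ {f@(suc _)} {l} ((_ , per-f) , least) per-l with l % f in eq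
  ... | zero  = m%n≡0⇒n∣m l f eq
  ... | suc j = contradiction
    (least (suc j) z<s λ x → trans (cong (λ z → g (x + z)) (sym eq))
                               (trans (period-%-invariant per-f x l) (per-l x)))
    (<⇒≱ (subst (_< f) eq (m%n<n l f)))

  minimalPeriod-unique : ∀ {m n} → MinimalPeriod g m → MinimalPeriod g n → m ≡ n
  minimalPeriod-unique m-min@((_ , m-per) , _) n-min@((_ , n-per) , _) =
    ∣-antisym (minimalPeriod-∣ m-min n-per) (minimalPeriod-∣ n-min m-per)

-- The recursion removes position 0 and shifts the sequence, in step with the recursion of `∣_∣`
-- along a vector.
countBelow : (ℕ → Bool) → ℕ → ℕ
countBelow g zero    = 0
countBelow g (suc n) = (if g 0 then suc else id) (countBelow (g ∘ suc) n)

countBelow-cong : ∀ {g h} n → (∀ x → g x ≡ h x) → countBelow g n ≡ countBelow h n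
countBelow-cong zero    g≗h = refl
countBelow-cong {h = h} (suc n) g≗h rewrite g≗h 0 =
  cong (if h 0 then suc else id) (countBelow-cong n (g≗h ∘ suc))

countBelow-+ : ∀ g m n → countBelow g (m + n) ≡ countBelow g m + countBelow (g ∘ _+_ m) n
countBelow-+ g zero    n = refl
countBelow-+ g (suc m) n with g 0
... | true  = cong suc (countBelow-+ (g ∘ suc) m n)
... | false = countBelow-+ (g ∘ suc) m n

countBelow-* : ∀ {g q} → Period g q → ∀ e → countBelow g (e * q) ≡ e * countBelow g q
countBelow-* per zero    = refl
countBelow-* {g} {q} per (suc e) = begin
  countBelow g (q + e * q)                               ≡⟨ countBelow-+ g q (e * q) ⟩
  countBelow g q + countBelow (g ∘ _+_ q) (e * q)       ≡⟨ cong (_+_ (countBelow g q)) (countBelow-cong (e * q) λ x →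
                                                              trans (cong g (+-comm q x)) (per x)) ⟩
  countBelow g q + countBelow g (e * q)                  ≡⟨ cong (_+_ (countBelow g q)) (countBelow-* per e) ⟩
  countBelow g q + e * countBelow g q                    ∎
  where open ≡-Reasoning

-- The interval of length `l + k` from 0 is cut after `l` and after `k`; by periodicity the last `l`
-- places count the same as the first `l`, and these cancel.
countBelow-shift : ∀ {g k} → Period g k → ∀ l → countBelow (g ∘ (_+ l)) k ≡ countBelow g k
countBelow-shift {g} {k} per l = +-cancelˡ-≡ (countBelow g l) _ _ (begin
  countBelow g l + countBelow (g ∘ (_+ l)) k   ≡⟨ cong (_+_ (countBelow g l)) (countBelow-cong k λ x → cong g (+-comm x l)) ⟩
  countBelow g l + countBelow (g ∘ _+_ l) k   ≡⟨ countBelow-+ g l k ⟨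
  countBelow g (l + k)                         ≡⟨ cong (countBelow g) (+-comm l k) ⟩
  countBelow g (k + l)                         ≡⟨ countBelow-+ g k l ⟩
  countBelow g k + countBelow (g ∘ _+_ k) l   ≡⟨ cong (_+_ (countBelow g k)) (countBelow-cong l λ x →
                                                    trans (cong g (+-comm k x)) (per x)) ⟩
  countBelow g k + countBelow g l              ≡⟨ +-comm (countBelow g k) _ ⟩
  countBelow g l + countBelow g k              ∎)
  where open ≡-Reasoning

-- Subsets of ℤ/k as k-periodic sequences

[m%n+o]%n≡[m+o]%n : ∀ m o n .{{_ : NonZero n}} → (m % n + o) % n ≡ (m + o) % n
[m%n+o]%n≡[m+o]%n m o n = begin
  (m % n + o) % n              ≡⟨ %-distribˡ-+ (m % n) o n ⟩
  (m % n % n + o % n) % n      ≡⟨ cong (λ z → (z + o % n) % n) (m%n%n≡m%n m n) ⟩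
  (m % n + o % n) % n          ≡⟨ %-distribˡ-+ m o n ⟨
  (m + o) % n                  ∎
  where open ≡-Reasoning

-- Modulo `o` the number `n * pred o` is minus `n`, so a shift can be undone without truncated
-- subtraction.
m+n*pred[o]+n≡m+n*o : ∀ m n o .{{_ : NonZero o}} → m + n * pred o + n ≡ m + n * o
m+n*pred[o]+n≡m+n*o m n o = begin
  m + n * pred o + n       ≡⟨ +-assoc m _ n ⟩
  m + (n * pred o + n)     ≡⟨ cong (_+_ m) (+-comm _ n) ⟩
  m + (n + n * pred o)     ≡⟨ cong (_+_ m) (*-suc n (pred o)) ⟨
  m + n * suc (pred o)     ≡⟨ cong (λ z → m + n * z) (suc-pred o) ⟩
  m + n * o                ∎
  where open ≡-Reasoning

module _ {k : ℕ} .{{_ : NonZero k}} where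

  opaque

    -- The indicator function extended periodically to all of ℕ. It is opaque, as is `ofSequence`,
    -- so that later proofs use the equations of this block instead of unfolding vectors.
    χ : Subset k → ℕ → Bool
    χ A x = Vec.lookup A (x mod k)

    χ≡lookup : ∀ A x → χ A x ≡ Vec.lookup A (x mod k)
    χ≡lookup A x = refl

    ofSequence : (ℕ → Bool) → Subset k
    ofSequence g = tabulate (g ∘ toℕ)

    χ-ofSequence : ∀ g x → χ (ofSequence g) x ≡ g (x % k)
    χ-ofSequence g x = trans (Vec.lookup∘tabulate (g ∘ toℕ) (x mod k)) (cong g (Fin.toℕ-fromℕ< _))

    χ-cong-% : ∀ A {x y} → x % k ≡ y % k → χ A x ≡ χ A y
    χ-cong-% A eq = cong (Vec.lookup A) (Fin.fromℕ<-cong _ _ eq _ _)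

  χ-period : ∀ A → Period (χ A) k
  χ-period A x = χ-cong-% A ([m+n]%n≡m%n x k)

  χ-toℕ : ∀ A i → χ A (toℕ i) ≡ Vec.lookup A i
  χ-toℕ A i = trans (χ≡lookup A (toℕ i)) (cong (Vec.lookup A) (Fin.toℕ-injective
    (trans (Fin.toℕ-fromℕ< _) (m<n⇒m%n≡m (Fin.toℕ<n i)))))

  χ-injective : ∀ {A B} → (∀ x → χ A x ≡ χ B x) → A ≡ B
  χ-injective {A} {B} eq = begin
    A                          ≡⟨ Vec.tabulate∘lookup A ⟨
    tabulate (Vec.lookup A)    ≡⟨ Vec.tabulate-cong (λ i → trans (sym (χ-toℕ A i)) (trans (eq (toℕ i)) (χ-toℕ B i))) ⟩
    tabulate (Vec.lookup B)    ≡⟨ Vec.tabulate∘lookup B ⟩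
    B                          ∎
    where open ≡-Reasoning

  χ-ofPeriodic : ∀ {g} → Period g k → ∀ x → χ (ofSequence g) x ≡ g x
  χ-ofPeriodic {g} per x = trans (χ-ofSequence g x) (period-%-invariant per 0 x)

  -- Reading `χ A` from position `l` onwards gives the translate of `A` by minus `l` modulo `k`.
  rotate : ℕ → Subset k → Subset k
  rotate l A = ofSequence (χ A ∘ (_+ l))

  χ-rotate : ∀ l A x → χ (rotate l A) x ≡ χ A (x + l)
  χ-rotate l A x = trans (χ-ofSequence (χ A ∘ (_+ l)) x) (χ-cong-% A ([m%n+o]%n≡[m+o]%n x l k))

  ≡rotate⁺ : ∀ A B {l} → (∀ x → χ A x ≡ χ B (x + l)) → A ≡ rotate l B
  ≡rotate⁺ A B {l} eq = χ-injective λ x → trans (eq x) (sym (χ-rotate l B x))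

  ≡rotate⁻ : ∀ {A} B {l} → A ≡ rotate l B → ∀ x → χ A x ≡ χ B (x + l)
  ≡rotate⁻ B {l} refl = χ-rotate l B

  -- The condition on all `x` amounts to an equality of two finite vectors, which is decidable.
  rotate? : ∀ A l B → Dec (∀ x → χ A x ≡ χ B (x + l))
  rotate? A l B = map′ (≡rotate⁻ B) (≡rotate⁺ A B) (Vec.≡-dec Bool._≟_ A (rotate l B))

  period? : ∀ A l → Dec (Period (χ A) l)
  period? A l = map′ (λ eq x → sym (eq x)) (λ eq x → sym (eq x)) (rotate? A l A)

  ∃-minimalPeriod : ∀ A → ∃ (MinimalPeriod (χ A))
  ∃-minimalPeriod A with ∃-least (λ l → (0 <? l) ×-dec period? A l) k (>-nonZero⁻¹ k , χ-period A)
  ... | f , f-per , least = f , f-per , λ l 0<l per → least l (0<l , per)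

  -- The least period exists and is unique, so it suffices to compute it and compare it with `n`.
  minimalPeriod? : ∀ n A → Dec (MinimalPeriod (χ A) n)
  minimalPeriod? n A with ∃-minimalPeriod A
  ... | f , f-min = map′ (λ { refl → f-min }) (minimalPeriod-unique f-min) (f ≟ n)

  rotate-period : ∀ A j {l} → Period (χ A) l → Period (χ (rotate j A)) l
  rotate-period A j {l} per x = begin
    χ (rotate j A) (x + l)    ≡⟨ χ-rotate j A (x + l) ⟩
    χ A (x + l + j)           ≡⟨ cong (χ A) ([m+n]+o≡[m+o]+n x l j) ⟩
    χ A (x + j + l)           ≡⟨ per (x + j) ⟩
    χ A (x + j)               ≡⟨ χ-rotate j A x ⟨
    χ (rotate j A) x          ∎
    where open ≡-Reasoning

  -- The two shifts add up to `j * k`, a period. Rotations are thus invertible, and periods of a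
  -- rotation pass back to `A`.
  rotate-back : ∀ A j → A ≡ rotate (j * pred k) (rotate j A)
  rotate-back A j = ≡rotate⁺ A (rotate j A) λ x → sym (begin
    χ (rotate j A) (x + j * pred k)    ≡⟨ χ-rotate j A _ ⟩
    χ A (x + j * pred k + j)           ≡⟨ cong (χ A) (m+n*pred[o]+n≡m+n*o x j k) ⟩
    χ A (x + j * k)                    ≡⟨ period-* (χ-period A) j x ⟩
    χ A x                              ∎)
    where open ≡-Reasoning

  rotate-minimalPeriod : ∀ {A} j {n} → MinimalPeriod (χ A) n → MinimalPeriod (χ (rotate j A)) n
  rotate-minimalPeriod {A} j ((0<n , per) , least) = (0<n , rotate-period A j per) ,
    λ l 0<l per-l → least l 0<l
      (subst (λ B → Period (χ B) l) (sym (rotate-back A j)) (rotate-period (rotate j A) (j * pred k) per-l))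

  -- If the two rotations agreed, `j ∸ i` would be a period of `rotate i A` and hence of `A`,
  -- positive and below `n`.
  rotate-injective : ∀ {A n} → MinimalPeriod (χ A) n → ∀ {i j} → i < j → j < n → rotate i A ≢ rotate j A
  rotate-injective {A} {n} (_ , least) {i} {j} i<j j<n eq = <⇒≱ (≤-<-trans (m∸n≤m j i) j<n)
    (least (j ∸ i) (m<n⇒0<n∸m i<j)
      (subst (λ B → Period (χ B) (j ∸ i)) (sym (rotate-back A i)) (rotate-period (rotate i A) (i * pred k) λ x → begin
        χ (rotate i A) (x + (j ∸ i))   ≡⟨ χ-rotate i A _ ⟩
        χ A (x + (j ∸ i) + i)          ≡⟨ cong (χ A) (trans (+-assoc x _ i) (cong (_+_ x) (m∸n+n≡m (<⇒≤ i<j)))) ⟩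
        χ A (x + j)                    ≡⟨ χ-rotate j A x ⟨
        χ (rotate j A) x               ≡⟨ cong (λ B → χ B x) eq ⟨
        χ (rotate i A) x               ∎)))
    where open ≡-Reasoning

∣∣≡countBelow : ∀ {n} (A : Subset n) g → (∀ i → g (toℕ i) ≡ Vec.lookup A i) → ∣ A ∣ ≡ countBelow g n
∣∣≡countBelow []          g eq = refl
∣∣≡countBelow (true  ∷ A) g eq rewrite eq zero = cong suc (∣∣≡countBelow A (g ∘ suc) (eq ∘ suc))
∣∣≡countBelow (false ∷ A) g eq rewrite eq zero = ∣∣≡countBelow A (g ∘ suc) (eq ∘ suc)

∣∣≡countBelow-χ : ∀ {k} .{{_ : NonZero k}} (A : Subset k) → ∣ A ∣ ≡ countBelow (χ A) k
∣∣≡countBelow-χ A = ∣∣≡countBelow A (χ A) (χ-toℕ A)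

∣rotate∣ : ∀ {k} .{{_ : NonZero k}} l (A : Subset k) → ∣ rotate l A ∣ ≡ ∣ A ∣
∣rotate∣ {k} l A = begin
  ∣ rotate l A ∣                     ≡⟨ ∣∣≡countBelow-χ (rotate l A) ⟩
  countBelow (χ (rotate l A)) k      ≡⟨ countBelow-cong k (χ-rotate l A) ⟩
  countBelow (χ A ∘ (_+ l)) k        ≡⟨ countBelow-shift (χ-period A) l ⟩
  countBelow (χ A) k                 ≡⟨ ∣∣≡countBelow-χ A ⟨
  ∣ A ∣                              ∎
  where open ≡-Reasoning

∣∣-period : ∀ {k q} .{{_ : NonZero k}} e (A : Subset k) → Period (χ A) q → k ≡ e * q →
            ∣ A ∣ ≡ e * countBelow (χ A) q
∣∣-period e A per k≡e*q =
  trans (∣∣≡countBelow-χ A) (trans (cong (countBelow (χ A)) k≡e*q) (countBelow-* per e))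

-- The subsets of a given size

-- Splitting on the first entry makes the lengths obey Pascal's rule.
choose : ∀ n → ℕ → List (Subset n)
choose zero    zero    = [] ∷ []
choose zero    (suc j) = []
choose (suc n) zero    = map (false ∷_) (choose n zero)
choose (suc n) (suc j) = map (true ∷_) (choose n j) ++ map (false ∷_) (choose n (suc j))

length-choose : ∀ n j → length (choose n j) ≡ n C j
length-choose zero    zero    = refl
length-choose zero    (suc j) = refl
length-choose (suc n) zero    = trans (List.length-map _ (choose n 0)) (length-choose n 0)
length-choose (suc n) (suc j) = begin
  length (map (true ∷_) (choose n j) ++ map (false ∷_) (choose n (suc j)))
    ≡⟨ List.length-++ (map (true ∷_) (choose n j)) ⟩
  length (map (true ∷_) (choose n j)) + length (map (false ∷_) (choose n (suc j)))
    ≡⟨ cong₂ _+_ (List.length-map _ (choose n j)) (List.length-map _ (choose n (suc j))) ⟩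
  length (choose n j) + length (choose n (suc j))
    ≡⟨ cong₂ _+_ (length-choose n j) (length-choose n (suc j)) ⟩
  n C j + n C suc j
    ≡⟨ nCk+nC[k+1]≡[n+1]C[k+1] n j ⟩
  suc n C suc j ∎
  where open ≡-Reasoning

choose-unique : ∀ n j → Unique (choose n j)
choose-unique zero    zero    = [] ∷ []
choose-unique zero    (suc j) = []
choose-unique (suc n) zero    = Unique.map⁺ Vec.∷-injectiveʳ (choose-unique n zero)
choose-unique (suc n) (suc j) = Unique.++⁺
  (Unique.map⁺ Vec.∷-injectiveʳ (choose-unique n j))
  (Unique.map⁺ Vec.∷-injectiveʳ (choose-unique n (suc j)))
  λ { (p , q) → case (∈-map⁻ _ p) (∈-map⁻ _ q) }
  where
  case : ∀ {A} → (∃ λ B → B ∈ choose n j × A ≡ true ∷ B) →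
         ¬ (∃ λ B → B ∈ choose n (suc j) × A ≡ false ∷ B)
  case (_ , _ , refl) (_ , _ , ())

∈-choose⁺ : ∀ {n j} {A : Subset n} → ∣ A ∣ ≡ j → A ∈ choose n j
∈-choose⁺ {A = []}        refl = here refl
∈-choose⁺ {A = true ∷ A}  refl = ∈-++⁺ˡ (∈-map⁺ (true ∷_) (∈-choose⁺ {A = A} refl))
∈-choose⁺ {j = zero}  {A = false ∷ A} eq = ∈-map⁺ (false ∷_) (∈-choose⁺ {A = A} eq)
∈-choose⁺ {suc n} {suc j} {A = false ∷ A} eq =
  ∈-++⁺ʳ (map (true ∷_) (choose n j)) (∈-map⁺ (false ∷_) (∈-choose⁺ {A = A} eq))

∈-choose⁻ : ∀ {n j} {A : Subset n} → A ∈ choose n j → ∣ A ∣ ≡ j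
∈-choose⁻ {zero}  {zero}  (here refl) = refl
∈-choose⁻ {suc n} {zero}  A∈ with ∈-map⁻ (false ∷_) A∈
... | B , B∈ , refl = ∈-choose⁻ B∈
∈-choose⁻ {suc n} {suc j} A∈ with ∈-++⁻ (map (true ∷_) (choose n j)) A∈
... | inj₁ A∈ˡ with B , B∈ , refl ← ∈-map⁻ (true ∷_) A∈ˡ = cong suc (∈-choose⁻ B∈)
... | inj₂ A∈ʳ with B , B∈ , refl ← ∈-map⁻ (false ∷_) A∈ʳ = ∈-choose⁻ B∈

-- Repeating a subset of ℤ/q around ℤ/k multiplies its size by `e`, and every set with period `q` is
-- the repetition of its part below `q`.
count-periodic : ∀ {k} q e j .{{_ : NonZero k}} .{{_ : NonZero q}} .{{_ : NonZero e}} → k ≡ e * q →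
                 length (filter (λ A → period? A q) (choose k (e * j))) ≡ q C j
count-periodic {k} q e j k≡e*q = begin
  length (filter P? (choose k (e * j)))   ≡⟨ ↭-length (unique-↭
    (Unique.filter⁺ P? (choose-unique k (e * j)))
    (Unique.map⁺ unroll-injective (choose-unique q j)) ⊆-unroll unroll-⊆) ⟩
  length (map unroll (choose q j))        ≡⟨ List.length-map unroll (choose q j) ⟩
  length (choose q j)                     ≡⟨ length-choose q j ⟩
  q C j                                   ∎
  where
  open ≡-Reasoning
  P? = λ A → period? {k} A q

  unroll : Subset q → Subset k
  unroll B = ofSequence (χ B)

  χ-unroll : ∀ B x → χ (unroll B) x ≡ χ B x
  χ-unroll B = χ-ofPeriodic (subst (Period (χ B)) (sym k≡e*q) (period-* (χ-period B) e))

  unroll-injective : ∀ {B B′} → unroll B ≡ unroll B′ → B ≡ B′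
  unroll-injective {B} {B′} eq = χ-injective λ x →
    trans (sym (χ-unroll B x)) (trans (cong (λ A → χ A x) eq) (χ-unroll B′ x))

  unroll-period : ∀ B → Period (χ (unroll B)) q
  unroll-period B x = trans (χ-unroll B (x + q)) (trans (χ-period B x) (sym (χ-unroll B x)))

  ∣unroll∣ : ∀ B → ∣ unroll B ∣ ≡ e * ∣ B ∣
  ∣unroll∣ B = begin
    ∣ unroll B ∣                            ≡⟨ ∣∣-period e (unroll B) (unroll-period B) k≡e*q ⟩
    e * countBelow (χ (unroll B)) q         ≡⟨ cong (e *_) (countBelow-cong q (χ-unroll B)) ⟩
    e * countBelow (χ B) q                  ≡⟨ cong (e *_) (∣∣≡countBelow-χ B) ⟨
    e * ∣ B ∣                               ∎

  unroll-⊆ : ∀ {A} → A ∈ map unroll (choose q j) → A ∈ filter P? (choose k (e * j))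
  unroll-⊆ A∈ with ∈-map⁻ unroll A∈
  ... | B , B∈ , refl = ∈-filter⁺ P?
    (∈-choose⁺ (trans (∣unroll∣ B) (cong (e *_) (∈-choose⁻ B∈)))) (unroll-period B)

  ⊆-unroll : ∀ {A} → A ∈ filter P? (choose k (e * j)) → A ∈ map unroll (choose q j)
  ⊆-unroll {A} A∈ with ∈-filter⁻ P? {xs = choose k (e * j)} A∈
  -- The size of `fold` comes from cancelling `e`: `e` copies of it make up `A`, which has `e * j`
  -- elements.
  ... | A∈′ , per = subst (_∈ map unroll (choose q j)) eq (∈-map⁺ unroll (∈-choose⁺ {A = fold}
      (*-cancelˡ-≡ ∣ fold ∣ j e (trans (sym (∣unroll∣ fold)) (trans (cong ∣_∣ eq) (∈-choose⁻ A∈′))))))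
    where
    fold : Subset q
    fold = ofSequence (χ A)
    eq : unroll fold ≡ A
    eq = χ-injective λ x → trans (χ-unroll fold x) (χ-ofPeriodic per x)

-- Translates modulo k as rotations

module _ {k : ℕ} .{{_ : NonZero k}} where

  ∈-elements⁺ : ∀ (A : Subset k) x → χ A x ≡ true → x % k ∈ elements A
  ∈-elements⁺ A x χx = subst (_∈ elements A) (Fin.toℕ-fromℕ< _)
    (∈-map⁺ toℕ (∈-filter⁺ (_∈? A) (∈-allFin (x mod k))
      (Vec.lookup⇒[]= (x mod k) A (trans (sym (χ≡lookup A x)) χx))))

  ∈-elements⁻ : ∀ (A : Subset k) {x} → x ∈ elements A → χ A x ≡ true
  ∈-elements⁻ A x∈ with ∈-map⁻ toℕ x∈
  ... | i , i∈ , refl = trans (χ-toℕ A i)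
    (Vec.[]=⇒lookup (proj₂ (∈-filter⁻ (_∈? A) {xs = allFin k} i∈)))

  +-cancelʳ-% : ∀ x y l → (x + l) % k ≡ (y + l) % k → x % k ≡ y % k
  +-cancelʳ-% x y l eq = trans (sym (shiftBack x)) (trans (cong (λ z → (z + l * pred k) % k) eq) (shiftBack y))
    where
    open ≡-Reasoning
    shiftBack : ∀ z → ((z + l) % k + l * pred k) % k ≡ z % k
    shiftBack z = begin
      ((z + l) % k + l * pred k) % k   ≡⟨ [m%n+o]%n≡[m+o]%n (z + l) _ k ⟩
      (z + l + l * pred k) % k         ≡⟨ cong (_% k) ([m+n]+o≡[m+o]+n z l _) ⟩
      (z + l * pred k + l) % k         ≡⟨ cong (_% k) (m+n*pred[o]+n≡m+n*o z l k) ⟩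
      (z + l * k) % k                  ≡⟨ [m+kn]%n≡m%n z l k ⟩
      z % k                            ∎

  -- Translation by `j` permutes ℤ/k, so equality of residue sets can be tested pointwise on the
  -- characteristic sequences. This is the bridge from the lists of the definitions to sequences.
  equalModulo⇔ : ∀ (A B : Subset k) j →
    EqualModulo k (elements A +ₛ j) (elements B) ⇔ (∀ x → χ A x ≡ χ B (x + j))
  equalModulo⇔ A B j = mk⇔ forward backward
    where
    A+j = residues k (elements A +ₛ j)

    ∈-A+j⁺ : ∀ x → χ A x ≡ true → (x + j) % k ∈ A+j
    ∈-A+j⁺ x χx = subst (_∈ A+j) ([m%n+o]%n≡[m+o]%n x j k)
      (∈-map⁺ (_% k) (∈-map⁺ (_+ j) (∈-elements⁺ A x χx)))

    ∈-A+j⁻ : ∀ {y} → y ∈ A+j → ∃ λ x → χ A x ≡ true × y ≡ (x + j) % k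
    ∈-A+j⁻ y∈ with ∈-map⁻ (_% k) y∈
    ... | z , z∈ , refl with ∈-map⁻ (_+ j) z∈
    ... | x , x∈ , refl = x , ∈-elements⁻ A x∈ , refl

    ∈-B⁺ : ∀ x → χ B x ≡ true → x % k ∈ residues k (elements B)
    ∈-B⁺ x χx = subst (_∈ residues k (elements B)) (m%n%n≡m%n x k)
      (∈-map⁺ (_% k) (∈-elements⁺ B x χx))

    ∈-B⁻ : ∀ {y} → y ∈ residues k (elements B) → ∃ λ x → χ B x ≡ true × y ≡ x % k
    ∈-B⁻ y∈ with ∈-map⁻ (_% k) y∈
    ... | x , x∈ , refl = x , ∈-elements⁻ B x∈ , refl

    forward : EqualModulo k (elements A +ₛ j) (elements B) → ∀ x → χ A x ≡ χ B (x + j)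
    forward eq x = Bool.⇔→≡ {z = true} (mk⇔ A⇒B B⇒A)
      where
      A⇒B : χ A x ≡ true → χ B (x + j) ≡ true
      A⇒B χx with ∈-B⁻ (to (eq {(x + j) % k}) (∈-A+j⁺ x χx))
      ... | y , χy , x+j≡y = trans (χ-cong-% B x+j≡y) χy
      B⇒A : χ B (x + j) ≡ true → χ A x ≡ true
      B⇒A χx+j with ∈-A+j⁻ (from (eq {(x + j) % k}) (∈-B⁺ (x + j) χx+j))
      ... | y , χy , x+j≡y+j = trans (χ-cong-% A (+-cancelʳ-% x y j x+j≡y+j)) χy

    backward : (∀ x → χ A x ≡ χ B (x + j)) → EqualModulo k (elements A +ₛ j) (elements B)
    backward eq {z} = mk⇔ A⇒B B⇒A
      where
      A⇒B : z ∈ A+j → z ∈ residues k (elements B)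
      A⇒B z∈ with ∈-A+j⁻ z∈
      ... | x , χx , refl = ∈-B⁺ (x + j) (trans (sym (eq x)) χx)
      B⇒A : z ∈ residues k (elements B) → z ∈ A+j
      B⇒A z∈ with ∈-B⁻ z∈
      ... | y , χy , refl = subst (_∈ A+j) x+j≡y (∈-A+j⁺ x
          (trans (eq x) (trans (χ-cong-% B x+j≡y) χy)))
        where
        -- A natural number congruent to `y` minus `j` modulo `k`.
        x = y + j * pred k
        x+j≡y : (x + j) % k ≡ y % k
        x+j≡y = begin
          (y + j * pred k + j) % k   ≡⟨ cong (_% k) (m+n*pred[o]+n≡m+n*o y j k) ⟩
          (y + j * k) % k            ≡⟨ [m+kn]%n≡m%n y j k ⟩
          y % k                      ∎
          where open ≡-Reasoning

  equalModulo-period⇔ : ∀ (A : Subset k) l →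
    EqualModulo k (elements A) (elements A +ₛ l) ⇔ Period (χ A) l
  equalModulo-period⇔ A l = mk⇔
    -- The translate stands on the right in the definition of the period length but on the left in
    -- `equalModulo⇔`, so the set equality is reversed in both directions.
    (λ eq x → sym (to (equalModulo⇔ A A l) (λ {z} → mk⇔ (from (eq {z})) (to (eq {z}))) x))
    (λ per {z} → let eq = from (equalModulo⇔ A A l) (λ x → sym (per x)) in mk⇔ (from (eq {z})) (to (eq {z})))

  isPeriodLength⇔ : ∀ (A : Subset k) n → IsPeriodLength k A n ⇔ MinimalPeriod (χ A) n
  isPeriodLength⇔ A n = mk⇔
    (λ ((0<n , eq) , least) → (0<n , to (equalModulo-period⇔ A n) eq) ,
       λ l 0<l per → least l 0<l (from (equalModulo-period⇔ A l) per))
    (λ ((0<n , per) , least) → (0<n , from (equalModulo-period⇔ A n) per) ,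
       λ l 0<l eq → least l 0<l (to (equalModulo-period⇔ A l) eq))

  -- A record, since Agda cannot recover A and B from Equivalent k (elements A) (elements B).
  record _~_ (A B : Subset k) : Set where
    constructor ⟨_⟩
    field equivalent : Equivalent k (elements A) (elements B)

  open _~_ public

  ~-refl : Reflexive _~_
  ~-refl {A} = ⟨ equivalent-refl k {elements A} ⟩

  ~-sym : Symmetric _~_
  ~-sym {A} {B} ⟨ A~B ⟩ = ⟨ equivalent-sym k {elements A} {elements B} A~B ⟩

  ~-trans : Transitive _~_
  ~-trans {A} {B} {C} ⟨ A~B ⟩ ⟨ B~C ⟩ = ⟨ equivalent-trans k {elements A} {elements B} {elements C} A~B B~C ⟩

  ~⁺ : ∀ {A B j} → j < k → A ≡ rotate j B → A ~ B
  ~⁺ {A} {B} {j} j<k A≡ = ⟨ j , j<k , from (equalModulo⇔ A B j) (≡rotate⁻ B A≡) ⟩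

  ~⁻ : ∀ {A B} → A ~ B → ∃ λ j → A ≡ rotate j B
  ~⁻ {A} {B} ⟨ j , _ , eq ⟩ = j , ≡rotate⁺ A B (to (equalModulo⇔ A B j) eq)

  _~?_ : ∀ A B → Dec (A ~ B)
  A ~? B = map′
    (λ (j , j<k , eq) → ⟨ j , j<k , from (equalModulo⇔ A B j) eq ⟩)
    (λ { ⟨ j , j<k , eq ⟩ → j , j<k , to (equalModulo⇔ A B j) eq })
    (anyUpTo? (λ j → rotate? A j B) k)

-- Sets with least period n and their rotation orbits

opaque

  -- The explicit list of the elements of 𝒜ₙ(r,k), opaque so that it unfolds only where this is
  -- requested.
  primitives : ∀ (n r k : ℕ) .{{_ : NonZero k}} → List (Subset k)
  primitives n r k = filter (minimalPeriod? n) (choose k r)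

module _ {n r k : ℕ} .{{_ : NonZero k}} where

  opaque
    unfolding primitives

    ∈-primitives⁺ : ∀ {A} → ∣ A ∣ ≡ r → MinimalPeriod (χ A) n → A ∈ primitives n r k
    ∈-primitives⁺ ∣A∣≡r n-min = ∈-filter⁺ (minimalPeriod? n) (∈-choose⁺ ∣A∣≡r) n-min

    ∈-primitives⁻ : ∀ {A} → A ∈ primitives n r k → ∣ A ∣ ≡ r × MinimalPeriod (χ A) n
    ∈-primitives⁻ A∈ with ∈-filter⁻ (minimalPeriod? n) {xs = choose k r} A∈
    ... | A∈′ , n-min = ∈-choose⁻ A∈′ , n-min

    primitives-unique : Unique (primitives n r k)
    primitives-unique = Unique.filter⁺ (minimalPeriod? n) (choose-unique k r)

  ∈-primitives⇒member : ∀ {A} → A ∈ primitives n r k → ∣ A ∣ ≡ r × IsPeriodLength k A n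
  ∈-primitives⇒member {A} A∈ with ∈-primitives⁻ A∈
  ... | ∣A∣≡r , n-min = ∣A∣≡r , from (isPeriodLength⇔ A n) n-min

  member⇒∈-primitives : ∀ {A} → ∣ A ∣ ≡ r × IsPeriodLength k A n → A ∈ primitives n r k
  member⇒∈-primitives {A} (∣A∣≡r , len) = ∈-primitives⁺ ∣A∣≡r (to (isPeriodLength⇔ A n) len)

  cardinality-𝒜 : HasCardinality (𝒜 n r k) (length (primitives n r k))
  cardinality-𝒜 = enumeration (Setoid.isEquivalence (𝒜 n r k)) sym (primitives n r k)
    (All.tabulate ∈-primitives⇒member) primitives-unique (Any.map sym ∘ member⇒∈-primitives)

  private
    -- For a set with least period `n` the first `n` rotations are distinct and already form its
    -- whole class.
    orbit : Subset k → List (Subset k)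
    orbit A = applyUpTo (λ j → rotate j A) n

  -- The orbits of the representatives are disjoint, have `n` members each and together exhaust the
  -- list.
  length-primitives : n ≤ k → ∀ {rs} → (∀ {A} → A ∈ rs → A ∈ primitives n r k) →
    AllPairs (λ A B → ¬ A ~ B) rs → (∀ {A} → A ∈ primitives n r k → Any (A ~_) rs) →
    length (primitives n r k) ≡ length rs * n
  length-primitives n≤k {rs} rs⊆ rs≁ cover = trans
    (↭-length (unique-↭ primitives-unique orbits-unique primitives⊆orbits orbits⊆primitives))
    (length-concat-map orbit (λ A → List.length-applyUpTo (λ j → rotate j A) n) rs)
    where
    min : ∀ {A} → A ∈ rs → MinimalPeriod (χ A) n
    min A∈ = proj₂ (∈-primitives⁻ (rs⊆ A∈))

    orbit⇒~ : ∀ {A B} → A ∈ orbit B → A ~ B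
    orbit⇒~ {A} {B} A∈ with ∈-applyUpTo⁻ (λ j → rotate j B) A∈
    -- `Equivalent` asks for a shift below `k`, and this is where `n ≤ k` enters.
    ... | j , j<n , A≡ = ~⁺ {A = A} {B} {j} (<-≤-trans j<n n≤k) A≡

    ~⇒orbit : ∀ {A B} → MinimalPeriod (χ B) n → A ~ B → A ∈ orbit B
    ~⇒orbit {A} {B} n-min@((0<n , per) , _) A~B with ~⁻ A~B
    ... | j , A≡ = subst (_∈ orbit B) (sym A≡rotate)
        (∈-applyUpTo⁺ (λ j → rotate j B) (m%n<n j n))
      where
      instance
        n≢0 : NonZero n
        n≢0 = >-nonZero 0<n
      A≡rotate : A ≡ rotate (j % n) B
      -- As `n` is a period of `B`, the shift `j` may be reduced modulo `n`.
      A≡rotate = ≡rotate⁺ A B λ x → trans (≡rotate⁻ B A≡ x) (sym (period-%-invariant per x j))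

    disjoint : ∀ {A B} → ¬ A ~ B → Disjoint (orbit A) (orbit B)
    disjoint A≁B (C∈A , C∈B) = A≁B (~-trans (~-sym (orbit⇒~ C∈A)) (orbit⇒~ C∈B))

    orbits-unique : Unique (concat (map orbit rs))
    orbits-unique = Unique.concat⁺
      (All.map⁺ (All.tabulate λ {A} A∈ → Unique.applyUpTo⁺₁ (λ j → rotate j A) n (rotate-injective (min A∈))))
      (AllPairs.map⁺ (AllPairs.map disjoint rs≁))

    primitives⊆orbits : ∀ {A} → A ∈ primitives n r k → A ∈ concat (map orbit rs)
    primitives⊆orbits {A} A∈ with find (cover A∈)
    ... | B , B∈ , A~B = ∈-concat⁺′ (~⇒orbit {A} {B} (min B∈) A~B) (∈-map⁺ orbit B∈)

    orbits⊆primitives : ∀ {A} → A ∈ concat (map orbit rs) → A ∈ primitives n r k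
    orbits⊆primitives A∈ with ∈-concat⁻′ (map orbit rs) A∈
    ... | _ , A∈orbit , orbit∈ with ∈-map⁻ orbit orbit∈
    ... | B , B∈ , refl with ∈-applyUpTo⁻ (λ j → rotate j B) A∈orbit | ∈-primitives⁻ (rs⊆ B∈)
    ... | j , _ , refl | ∣B∣≡r , n-min =
      ∈-primitives⁺ (trans (∣rotate∣ j B) ∣B∣≡r) (rotate-minimalPeriod j n-min)

  cardinality-𝒫 : n ≤ k → ∃ λ p → HasCardinality (𝒫 n r k) p × length (primitives n r k) ≡ p * n
  cardinality-𝒫 n≤k =
    let rs , rs⊆ , rs≁ , cover = ∃-representatives ~-refl _~?_ (primitives n r k) in
    length rs
    , enumeration {_~_ = λ A B → Equivalent k (elements A) (elements B)} (Setoid.isEquivalence (𝒫 n r k))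
        (λ {A} {B} → equivalent-sym k {elements A} {elements B}) rs (All.tabulate (∈-primitives⇒member ∘ rs⊆))
        (AllPairs.map (λ A≁B A~B → A≁B ⟨ A~B ⟩) rs≁)
        (Any.map (equivalent ∘ ~-sym) ∘ cover ∘ member⇒∈-primitives)
    , length-primitives n≤k rs⊆ rs≁ cover

-- Double counting with Möbius weights

module _ {k r n m d : ℕ} .{{_ : NonZero k}} .{{_ : NonZero n}} .{{_ : NonZero m}} .{{_ : NonZero d}}
         (k≡n*d : k ≡ n * d) (r≡m*d : r ≡ m * d) where

  private
    g = gcd n m

    instance
      g≢0 : NonZero g
      g≢0 = ≢-nonZero (gcd[m,n]≢0 n m (inj₁ (≢-nonZero⁻¹ n)))

    M : ℕ → ℤ
    M i = μ (suc i)

    R? : ∀ i (A : Subset k) → Dec (Period (χ A) (n / suc i))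
    R? i A = period? A (n / suc i)

    ∈-g⁻ : ∀ {i} → i ∈ divisors g → (suc i ∣ n) × (suc i ∣ m)
    ∈-g⁻ i∈ = ∣-trans (∈-divisors⁻ i∈) (gcd[m,n]∣m n m) , ∣-trans (∈-divisors⁻ i∈) (gcd[m,n]∣n n m)

    rescale : ∀ {s x y} .{{_ : NonZero s}} → s ∣ x → y ≡ x * d → y ≡ (s * d) * (x / s)
    rescale {s} {x} {y} s∣x y≡ = begin
      y                   ≡⟨ y≡ ⟩
      x * d               ≡⟨ cong (_* d) (m/n*n≡m s∣x) ⟨
      x / s * s * d       ≡⟨ *-assoc (x / s) s d ⟩
      x / s * (s * d)     ≡⟨ *-comm (x / s) _ ⟩
      s * d * (x / s)     ∎
      where open ≡-Reasoning

    -- With `s = suc i`, both `k = (s d)(n/s)` and `r = (s d)(m/s)`, so `count-periodic` applies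
    -- with `s d` repetitions.
    term : ∀ {i} → i ∈ divisors g →
           + ((n / suc i) C (m / suc i)) ℤ.* M i ≡ + length (filter (R? i) (choose k r)) ℤ.* M i
    term {i} i∈ = cong (λ z → + z ℤ.* M i) (sym (trans
      (cong (λ z → length (filter (R? i) (choose k z))) (rescale (proj₂ (∈-g⁻ i∈)) r≡m*d))
      (count-periodic (n / suc i) (suc i * d) (m / suc i)
        {{_}} {{>-nonZero (m≥n⇒m/n>0 (∣⇒≤ (proj₁ (∈-g⁻ i∈))))}} {{m*n≢0 (suc i) d}}
        (rescale (proj₁ (∈-g⁻ i∈)) k≡n*d))))

    module _ (A : Subset k) (∣A∣≡r : ∣ A ∣ ≡ r) where

      -- The contribution of `A` to the double sum once the sum over sets is taken outside.
      weight : ℤ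
      weight = sumOver M (filter (λ i → R? i A) (divisors g))

      -- Each `n/s` divides `n`, so none of them is a period and the sum is empty.
      weight-aperiodic : ¬ Period (χ A) n → weight ≡ 0ℤ
      weight-aperiodic ¬per = cong (sumOver M) (List.filter-none (λ i → R? i A)
        (All.tabulate λ {i} i∈ per → ¬per (period-∣ per (m/n∣m (proj₁ (∈-g⁻ i∈))))))

      module _ {f t} (f-min : MinimalPeriod (χ A) f) (n≡t*f : n ≡ t * f) where
        private
          f-per = proj₂ (proj₁ f-min)
          instance
            t≢0 : NonZero t
            t≢0 = ∣⇒NonZero (divides f (trans n≡t*f (*-comm t f)))
            f≢0 : NonZero f
            f≢0 = >-nonZero (proj₁ (proj₁ f-min))

          -- The set `A` consists of `t d` blocks of length `f` with equally many elements, so `t d`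
          -- divides `r = m d`; then `d` cancels.
          t∣m : t ∣ m
          t∣m = *-cancelʳ-∣ d (divides (countBelow (χ A) f) (begin
            m * d                              ≡⟨ trans (sym r≡m*d) (sym ∣A∣≡r) ⟩
            ∣ A ∣                              ≡⟨ ∣∣-period (t * d) A f-per k≡ ⟩
            t * d * countBelow (χ A) f         ≡⟨ *-comm (t * d) _ ⟩
            countBelow (χ A) f * (t * d)       ∎))
            where
            open ≡-Reasoning
            k≡ : k ≡ t * d * f
            k≡ = trans k≡n*d (trans (cong (_* d) n≡t*f) ([m*n]*o≡[m*o]*n t f d))

          t∣g : t ∣ g
          t∣g = gcd-greatest (divides f (trans n≡t*f (*-comm t f))) t∣m

          -- A period `n/s` is a multiple `c f` of the least one, so `t f = n = c s f` and
          -- `t = c s`.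
          ⊆ : ∀ {i} → i ∈ filter (λ i → R? i A) (divisors g) → i ∈ divisors t
          ⊆ {i} i∈ with ∈-filter⁻ (λ i → R? i A) {xs = divisors g} i∈
          ... | i∈g , per with minimalPeriod-∣ f-min per
          ... | divides c n/s≡c*f = ∈-divisors⁺ (divides c (*-cancelʳ-≡ t (c * suc i) f (begin
            t * f               ≡⟨ n≡t*f ⟨
            n                   ≡⟨ m/n*n≡m (proj₁ (∈-g⁻ i∈g)) ⟨
            n / suc i * suc i   ≡⟨ cong (_* suc i) n/s≡c*f ⟩
            c * f * suc i       ≡⟨ [m*n]*o≡[m*o]*n c f (suc i) ⟩
            c * suc i * f       ∎)))
            where open ≡-Reasoning

          -- From `t = c s` one gets `n/s = c f`, a multiple of the least period.
          ⊇ : ∀ {i} → i ∈ divisors t → i ∈ filter (λ i → R? i A) (divisors g)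
          ⊇ {i} i∈ with ∈-divisors⁻ {t} i∈
          ... | s∣t@(divides c t≡c*s) = ∈-filter⁺ (λ i → R? i A) (∈-divisors⁺ (∣-trans s∣t t∣g))
            (period-∣ f-per (divides c (begin
              n / suc i                 ≡⟨ cong (_/ suc i) (trans n≡t*f (trans (cong (_* f) t≡c*s)
                                                                     ([m*n]*o≡[m*o]*n c (suc i) f))) ⟩
              c * f * suc i / suc i     ≡⟨ m*n/n≡m (c * f) (suc i) ⟩
              c * f                     ∎)))
            where open ≡-Reasoning

        weight≡sum-μ : weight ≡ sumOver M (divisors t)
        weight≡sum-μ = sumOver-↭ M (unique-↭
          (Unique.filter⁺ (λ i → R? i A) (divisors-unique g)) (divisors-unique t) ⊆ ⊇)

      weight-minimal : MinimalPeriod (χ A) n → weight ≡ 1ℤ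
      -- For `t = 1` the only divisor is 1, and the sum computes to `μ 1 = 1`.
      weight-minimal n-min = weight≡sum-μ {t = 1} n-min (sym (*-identityˡ n))

      -- If `n` is a period at all, it is `t` times the least one. The case `t = 1` is excluded by
      -- the hypothesis, and for larger `t` the Möbius sum vanishes.
      weight-nonminimal : ¬ MinimalPeriod (χ A) n → weight ≡ 0ℤ
      weight-nonminimal ¬n-min with period? A n
      ... | no ¬per = weight-aperiodic ¬per
      ... | yes per with ∃-minimalPeriod A
      ... | f , f-min with minimalPeriod-∣ f-min per
      ... | divides zero n≡0 = contradiction n≡0 (≢-nonZero⁻¹ n)
      ... | divides (suc zero) n≡f = contradiction
        (subst (MinimalPeriod (χ A)) (sym (trans n≡f (*-identityˡ f))) f-min) ¬n-min
      ... | divides t@(suc (suc _)) n≡t*f = trans (weight≡sum-μ {t = t} f-min n≡t*f) (sum-μ≡0 t (s<s z<s))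

  opaque
    unfolding primitives

    -- The pairs of a set `A` of size `r` and a divisor `s` with `n/s` a period of `A`, weighted by
    -- `μ s`, are summed first by `s` and then by `A`.
    length-primitives≡divisorSum :
      + length (primitives n r k) ≡ divisorSum g (λ s → + ((n / s) C (m / s)) ℤ.* μ s)
    length-primitives≡divisorSum = sym (begin
      sumOver (λ i → + ((n / suc i) C (m / suc i)) ℤ.* M i) (divisors g)
        ≡⟨ sumOver-cong (divisors g) term ⟩
      sumOver (λ i → + length (filter (R? i) (choose k r)) ℤ.* M i) (divisors g)
        ≡⟨ sumOver-double-count R? M (divisors g) (choose k r) ⟩
      sumOver (λ A → sumOver M (filter (λ i → R? i A) (divisors g))) (choose k r)
        ≡⟨ sumOver-indicator (minimalPeriod? n) _ (choose k r)
             (λ {A} A∈ → weight-minimal A (∈-choose⁻ A∈)) (λ {A} A∈ → weight-nonminimal A (∈-choose⁻ A∈)) ⟩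
      + length (primitives n r k) ∎)
      where open ≡-Reasoning

  counts : ∃₂ λ p a → HasCardinality (𝒫 n r k) p × HasCardinality (𝒜 n r k) a ×
    (+ p) ℚ./ 1 ≡ (+ a) ℚ./ n ×
    (+ a) ℚ./ n ≡ divisorSum g (λ s → + ((n / s) C (m / s)) ℤ.* μ s) ℚ./ n
  counts =
    let p , 𝒫-card , a≡p*n = cardinality-𝒫 {n} {r} {k} (∣⇒≤ (divides d (trans k≡n*d (*-comm n d)))) in
    p , length (primitives n r k) , 𝒫-card , cardinality-𝒜 , p/1≡a/n n {p} a≡p*n ,
    cong (ℚ._/ n) length-primitives≡divisorSum
    where
    -- A fresh `n` can be matched as a successor, which exposes the denominator; the unnormalised
    -- fractions then agree by cross-multiplication.
    p/1≡a/n : ∀ n .{{_ : NonZero n}} {p a} → a ≡ p * n → (+ p) ℚ./ 1 ≡ (+ a) ℚ./ n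
    p/1≡a/n (suc n) {p} refl = fromℚᵘ-cong {mkℚᵘ (+ p) 0} {mkℚᵘ (+ (p * suc n)) n}
      (*≡* (trans (sym (ℤ.pos-* p (suc n))) (sym (ℤ.*-identityʳ _))))

theorem1 : (k r : ℕ) .{{_ : NonZero k}} → 2 ≤ k → 1 ≤ r → r ≤ k →
    ((n m d : ℕ) .{{_ : NonZero n}} .{{_ : NonZero m}} .{{_ : NonZero d}} →
    k ≡ n * d → r ≡ m * d →
    ∃₂ λ p a → HasCardinality (𝒫 n r k) p × HasCardinality (𝒜 n r k) a ×
    (+ p) ℚ./ 1 ≡ (+ a) ℚ./ n ×
    (+ a) ℚ./ n ≡ divisorSum (gcd n m) (λ s → + ((n / s) C (m / s)) ℤ.* μ s) ℚ./ n)
    ×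
    (∃₂ λ p a → HasCardinality (𝒫 k r k) p × HasCardinality (𝒜 k r k) a ×
    (+ p) ℚ./ 1 ≡ (+ a) ℚ./ k ×
    (+ a) ℚ./ k ≡ divisorSum (gcd k r) (λ s → + ((k / s) C (r / s)) ℤ.* μ s) ℚ./ k)
theorem1 k r _ 1≤r _ =
  (λ n m d k≡n*d r≡m*d → counts k≡n*d r≡m*d) ,
  -- The case `n = k`, `m = r`, `d = 1`, where `1 ≤ r` makes `m` nonzero.
  counts {{_}} {{_}} {{>-nonZero 1≤r}} {{_}} (sym (*-identityʳ k)) (sym (*-identityʳ r))
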